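{- There exists an infinite family of (pairwise non-isomorphic) Turánable oriented graphs, none of which is a subgraph of $D_s$ for any positive integer $s$.
   Context: An oriented graph is a digraph without loops, parallel edges, or 2-cycles. A regular tournament is a tournament in which every vertex has in-degree equal to out-degree. An oriented graph $H$ is Turánable if there exists $n_0$ such that every regular tournament on $n\geqslant n_0$ vertices contains a copy of $H$ as a (not necessarily induced) subdigraph. $TT_s$ is the transitive tournament on $s$ vertices, and $D_s=D_{s,s,s}$ is the tournament on $3s$ vertices obtained from the directed triangle $C_3$ by replacing each of its vertices with a copy of $TT_s$ (all edges between two copies being directed as the corresponding edge of $C_3$). -}

module Defs where

open import Data.Fin using (Fin; _<_)
open import Data.Fin.Patterns using (0F; 1F; 2F)
open import Data.Fin.Properties using (_≟_; _<?_; <-asym)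
open import Data.Nat using (ℕ; _≥_)
open import Data.Product using (∃-syntax; _×_)
open import Data.Product.Relation.Binary.Lex.Strict using (×-Lex; ×-asymmetric; ×-decidable)
open import Data.Sum using (_⊎_)
open import Data.Vec using (allFin; count)
open import Function.Bundles using (_⇔_)
open import Function.Definitions using (Bijective; Injective)
open import Level using (0ℓ)
open import Relation.Binary using (Asymmetric; Decidable; Rel)
open import Relation.Binary.PropositionalEquality using (_≡_; _≢_; resp₂; sym)
open import Relation.Nullary using (no; yes)

-- Asymmetry excludes both 2-cycles and loops (a loop is the case u = v).
-- Edges are a relation, so parallel edges do not arise: proofs of u ⟶ v are
-- never compared.  Decidability holds classically for every graph.
record OrientedGraph (V : Set) : Set₁ where
  infix 4 _⟶_ _⟶?_
  field
    _⟶_  : Rel V 0ℓ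
    _⟶?_ : Decidable _⟶_
    asym : Asymmetric _⟶_

open OrientedGraph

module _ {V W : Set} where

  infix 4 _≅_ _⊑_

  _≅_ : OrientedGraph V → OrientedGraph W → Set
  G ≅ H = ∃[ f ] Bijective _≡_ _≡_ f × (∀ u v → _⟶_ G u v ⇔ _⟶_ H (f u) (f v))

  -- H contains a copy of G, not necessarily induced.
  _⊑_ : OrientedGraph V → OrientedGraph W → Set
  G ⊑ H = ∃[ f ] Injective _≡_ _≡_ f × (∀ u v → _⟶_ G u v → _⟶_ H (f u) (f v))

IsTournament : {V : Set} → OrientedGraph V → Set
IsTournament G = ∀ u v → u ≢ v → _⟶_ G u v ⊎ _⟶_ G v u

module _ {n : ℕ} (G : OrientedGraph (Fin n)) where

  outDegree inDegree : Fin n → ℕ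
  outDegree v = count (λ u → _⟶?_ G v u) (allFin n)
  inDegree  v = count (λ u → _⟶?_ G u v) (allFin n)

  IsRegularTournament : Set
  IsRegularTournament = IsTournament G × (∀ v → inDegree v ≡ outDegree v)

Turánable : {V : Set} → OrientedGraph V → Set₁
Turánable H =
  ∃[ n₀ ] ∀ n → n ≥ n₀ → (T : OrientedGraph (Fin n)) → IsRegularTournament T → H ⊑ T

TT : (s : ℕ) → OrientedGraph (Fin s)
TT s = record { _⟶_ = _<_ ; _⟶?_ = _<?_ ; asym = <-asym }

data C₃-Edge : Rel (Fin 3) 0ℓ where
  0⟶1 : C₃-Edge 0F 1F
  1⟶2 : C₃-Edge 1F 2F
  2⟶0 : C₃-Edge 2F 0F

C₃ : OrientedGraph (Fin 3)
C₃ = record { _⟶_ = C₃-Edge ; _⟶?_ = edge? ; asym = edge-asym }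
  where
  edge? : Decidable C₃-Edge
  edge? 0F 0F = no λ ()
  edge? 0F 1F = yes 0⟶1
  edge? 0F 2F = no λ ()
  edge? 1F 0F = no λ ()
  edge? 1F 1F = no λ ()
  edge? 1F 2F = yes 1⟶2
  edge? 2F 0F = yes 2⟶0
  edge? 2F 1F = no λ ()
  edge? 2F 2F = no λ ()

  edge-asym : Asymmetric C₃-Edge
  edge-asym 0⟶1 ()
  edge-asym 1⟶2 ()
  edge-asym 2⟶0 ()

-- The vertex (i , a) is vertex a of the copy of TT s that replaces vertex i
-- of C₃.  There is an edge (i , a) ⟶ (j , b) when i ⟶ j in C₃, or when
-- i ≡ j and a < b.
D : (s : ℕ) → OrientedGraph (Fin 3 × Fin s)
D s = record
  { _⟶_  = ×-Lex _≡_ (_⟶_ C₃) (_⟶_ (TT s))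
  ; _⟶?_ = ×-decidable _≟_ (_⟶?_ C₃) (_⟶?_ (TT s))
  ; asym = ×-asymmetric {_<₂_ = _⟶_ (TT s)} sym (resp₂ (_⟶_ C₃)) (asym C₃)
             (λ {a} {b} → asym (TT s) {a} {b})
  }

{-# OPTIONS --safe #-}

-- Every edge of the graph H₆ below, a transitive triangle with a cyclic
-- triangle erected on each of its edges, lies in a cyclic triangle.  In D s a
-- cyclic triangle meets all three parts, so a copy of H₆ in D s would project
-- to a transitive triangle in C₃, which does not exist.
--
-- In a regular tournament on n vertices, an edge u ⟶ v satisfies
-- |N⁺(v)| + |N⁻(u)| = n − 1, while N⁺(v) ∪ N⁻(u) misses u, v and every w with
-- u ⟶ w ⟶ v.  Hence u ⟶ v is in at least one cyclic triangle, and in at least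
-- three if there are two such w.  A transitive triangle b ⟶ c ⟶ d whose edge
-- b ⟶ d has a second such w thus extends to H₆ with distinct apexes.
--
-- Adding isolated vertices to H₆ gives the infinite family.
module Submission where

open import Defs
open import Data.Bool using (if_then_else_; true; false)
open import Data.Empty using (⊥)
open import Data.Fin using (Fin; zero; suc)
open import Data.Fin.Patterns using (0F; 1F; 2F; 3F; 4F; 5F)
import Data.Fin.Properties as Fin
open import Data.Fin.Permutation using (↔⇒≡)
open import Data.Fin.Properties using (_≟_; any?; ¬∀⟶∃¬; <⇒notInjective; <-trans; suc-injective)
open import Data.List using (List; []; _∷_; length)
open import Data.List.Membership.Propositional using (_∈_; _∉_)
import Data.List.Membership.DecPropositional as DecMembership
open import Data.List.Relation.Unary.All as All using (All; []; _∷_)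
open import Data.List.Relation.Unary.All.Properties using (All¬⇒¬Any; ¬Any⇒All¬)
open import Data.List.Relation.Unary.Any using (here; there)
open import Data.List.Relation.Unary.AllPairs using ([]; _∷_)
open import Data.List.Relation.Unary.Unique.Propositional using (Unique)
open import Data.Nat using (ℕ; zero; suc; _+_; _⊔_; _≤_; _<_; _≥_; z≤n; s≤s; s≤s⁻¹)
open import Data.Nat.Properties hiding (_≟_; <-trans; suc-injective)
open import Data.Product using (Σ-syntax; ∃-syntax; _×_; _,_; proj₁; proj₂)
open import Data.Product.Properties using (≡-dec)
open import Data.Sum using (inj₁; inj₂)
import Data.Vec as Vec
open import Data.Vec using (Vec; []; _∷_; lookup)
open import Data.Vec.Relation.Unary.All using ([]; _∷_)
open import Data.Vec.Relation.Unary.AllPairs using ([]; _∷_)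
import Data.Vec.Relation.Unary.Unique.Propositional as VecUnique
open import Data.Vec.Relation.Unary.Unique.Propositional.Properties using (lookup-injective)
open import Function using (_∘_)
open import Function.Bundles using (mk⤖)
open import Function.Definitions using (Injective)
open import Function.Properties.Bijection using (⤖⇒↔)
open import Relation.Binary.PropositionalEquality
open import Relation.Nullary using (¬_; Dec; does; yes; no; contradiction)
open import Relation.Nullary.Decidable using (¬?; _×-dec_; from-yes; decidable-stable; dec-true; True; toWitness)
open import Relation.Unary using (Pred; Decidable)
open import Algebra.Properties.CommutativeMonoid.Sum +-0-commutativeMonoid
  using (sum; ∑-distrib-+; sum-replicate-zero)

open OrientedGraph

-- Counting in Fin n

𝟙 : {A : Set} → Dec A → ℕ
𝟙 a? = if does a? then 1 else 0

sum-mono-≤ : ∀ {n} {f g : Fin n → ℕ} → (∀ i → f i ≤ g i) → sum f ≤ sum g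
sum-mono-≤ {zero}  f≤g = z≤n
sum-mono-≤ {suc _} f≤g = +-mono-≤ (f≤g zero) (sum-mono-≤ (f≤g ∘ suc))

sum-1 : ∀ n → sum {n} (λ _ → 1) ≡ n
sum-1 zero    = refl
sum-1 (suc n) = cong suc (sum-1 n)

count-tabulate : ∀ {A : Set} {P : Pred A _} (P? : Decidable P) {n} (f : Fin n → A) →
                 Vec.count P? (Vec.tabulate f) ≡ sum (λ i → 𝟙 (P? (f i)))
count-tabulate P? {zero}  f = refl
count-tabulate P? {suc n} f with does (P? (f zero))
... | true  = cong suc (count-tabulate P? (f ∘ suc))
... | false = count-tabulate P? (f ∘ suc)

sum-𝟙-≟ : ∀ {n} (i : Fin n) → sum (λ j → 𝟙 (i ≟ j)) ≡ 1
sum-𝟙-≟ {suc n} zero    = cong suc (sum-replicate-zero n)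
sum-𝟙-≟ {suc n} (suc i) = sum-𝟙-≟ i

module _ {n : ℕ} where

  -- A list as a function on `Fin n`, so that its length can be compared pointwise under `sum` with
  -- sums of neighbourhood indicators.
  multiplicity : List (Fin n) → Fin n → ℕ
  multiplicity []       i = 0
  multiplicity (x ∷ xs) i = 𝟙 (x ≟ i) + multiplicity xs i

  sum-multiplicity : ∀ xs → sum (multiplicity xs) ≡ length xs
  sum-multiplicity []       = sum-replicate-zero n
  sum-multiplicity (x ∷ xs) = trans (∑-distrib-+ (λ j → 𝟙 (x ≟ j)) (multiplicity xs))
                                    (cong₂ _+_ (sum-𝟙-≟ x) (sum-multiplicity xs))

  ∉⇒multiplicity≡0 : ∀ xs {i} → i ∉ xs → multiplicity xs i ≡ 0
  ∉⇒multiplicity≡0 []       i∉ = refl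
  ∉⇒multiplicity≡0 (x ∷ xs) {i} i∉ with x ≟ i
  ... | yes x≡i = contradiction (here (sym x≡i)) i∉
  ... | no _    = ∉⇒multiplicity≡0 xs (i∉ ∘ there)

  ∈⇒multiplicity≥1 : ∀ {xs i} → i ∈ xs → 1 ≤ multiplicity xs i
  ∈⇒multiplicity≥1 {x ∷ xs} {i} i∈ with x ≟ i | i∈
  ... | yes _  | _         = s≤s z≤n
  ... | no x≢i | here i≡x  = contradiction (sym i≡x) x≢i
  ... | no _   | there i∈′ = ∈⇒multiplicity≥1 i∈′

  unique⇒multiplicity≤1 : ∀ {xs} → Unique xs → ∀ i → multiplicity xs i ≤ 1
  unique⇒multiplicity≤1 []                        i = z≤n
  unique⇒multiplicity≤1 {x ∷ xs} (x∉xs ∷ xs-uniq) i with x ≟ i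
  ... | yes refl = ≤-reflexive (cong suc (∉⇒multiplicity≡0 xs (All¬⇒¬Any x∉xs)))
  ... | no _     = unique⇒multiplicity≤1 xs-uniq i

-- If every `j` were hit, a choice of preimages would inject `Fin n` into the smaller `Fin m`.
fresh : ∀ {m n} {f : Fin m → Fin n} → Injective _≡_ _≡_ f → m < n →
        ∃[ j ] ∀ i → f i ≢ j
fresh {m} {n} {f} f-inj m<n =
  let j , j∉f = ¬∀⟶∃¬ n (λ j → ∃[ i ] f i ≡ j) (λ j → any? (λ i → f i ≟ j)) not-onto
  in  j , λ i fi≡j → j∉f (i , fi≡j)
  where
  not-onto : ¬ (∀ j → ∃[ i ] f i ≡ j)
  not-onto onto = <⇒notInjective {f = proj₁ ∘ onto} m<n
    λ {j} {k} eq → trans (sym (proj₂ (onto j))) (trans (cong f eq) (proj₂ (onto k)))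

-- Oriented graphs

module _ {V : Set} (G : OrientedGraph V) where

  ⟶⇒≢ : ∀ {u v} → _⟶_ G u v → u ≢ v
  ⟶⇒≢ uv refl = asym G uv uv

  path-ends-≢ : ∀ {u v w} → _⟶_ G u v → _⟶_ G v w → u ≢ w
  path-ends-≢ uv vw refl = asym G uv vw

≅⇒order≡ : ∀ {m n} {G : OrientedGraph (Fin m)} {H : OrientedGraph (Fin n)} → G ≅ H → m ≡ n
≅⇒order≡ (_ , f-bij , _) = ↔⇒≡ (⤖⇒↔ (mk⤖ f-bij))

module _ {m : ℕ} (G : OrientedGraph (Fin m)) where

  addIsolated : OrientedGraph (Fin (suc m))
  addIsolated = record { _⟶_ = E ; _⟶?_ = E? ; asym = λ {u} {v} → E-asym u v }
    where
    E : Fin (suc m) → Fin (suc m) → Set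
    E (suc u) (suc v) = _⟶_ G u v
    E _       _       = ⊥

    E? : ∀ u v → Dec (E u v)
    E? zero    _       = no λ ()
    E? (suc u) zero    = no λ ()
    E? (suc u) (suc v) = _⟶?_ G u v

    E-asym : ∀ u v → E u v → ¬ E v u
    E-asym (suc u) (suc v) = asym G

  addIsolated-⊑⁻ : ∀ {W} {K : OrientedGraph W} → addIsolated ⊑ K → G ⊑ K
  addIsolated-⊑⁻ (f , f-inj , f-hom) =
    f ∘ suc , suc-injective ∘ f-inj , λ u v → f-hom (suc u) (suc v)

  addIsolated-⊑⁺ : ∀ {n} {K : OrientedGraph (Fin n)} → m < n → G ⊑ K → addIsolated ⊑ K
  addIsolated-⊑⁺ {n} {K} m<n (f , f-inj , f-hom) = g , g-inj _ _ , g-hom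
    where
    j    = proj₁ (fresh f-inj m<n)
    j∉f  = proj₂ (fresh f-inj m<n)

    g : Fin (suc m) → Fin n
    g zero    = j
    g (suc u) = f u

    g-inj : ∀ u v → g u ≡ g v → u ≡ v
    g-inj zero    zero    eq = refl
    g-inj zero    (suc v) eq = contradiction (sym eq) (j∉f v)
    g-inj (suc u) zero    eq = contradiction eq (j∉f u)
    g-inj (suc u) (suc v) eq = cong suc (f-inj eq)

    g-hom : ∀ u v → _⟶_ addIsolated u v → _⟶_ K (g u) (g v)
    g-hom (suc u) (suc v) = f-hom u v

  addIsolated-Turánable : Turánable G → Turánable addIsolated
  addIsolated-Turánable (n₀ , G-in) =
    -- The bound `suc m` leaves room in `T` for a vertex outside the copy of `G`.
    n₀ ⊔ suc m , λ n n≥ T T-reg →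
      addIsolated-⊑⁺ {K = T} (m⊔n≤o⇒n≤o n₀ (suc m) n≥)
                     (G-in n (m⊔n≤o⇒m≤o n₀ (suc m) n≥) T T-reg)

-- Cyclic triangles in D s

module _ {s : ℕ} where

  -- If `u` and `v` share a part, the other two edges project to a 2-cycle or a loop in `C₃`, or the
  -- whole triangle is a cycle in a linear order.
  cyclic-triangle-crosses : ∀ {u v w} → _⟶_ (D s) u v → _⟶_ (D s) v w → _⟶_ (D s) w u →
                            C₃-Edge (proj₁ u) (proj₁ v)
  cyclic-triangle-crosses (inj₁ uv)         _                 _                 = uv
  cyclic-triangle-crosses (inj₂ (refl , _)) (inj₁ vw)         (inj₁ wu)         =
    contradiction wu (asym C₃ vw)
  cyclic-triangle-crosses (inj₂ (refl , _)) (inj₁ vw)         (inj₂ (refl , _)) =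
    contradiction vw (asym C₃ vw)
  cyclic-triangle-crosses (inj₂ (refl , _)) (inj₂ (refl , _)) (inj₁ wu)         =
    contradiction wu (asym C₃ wu)
  cyclic-triangle-crosses (inj₂ (_ , u<v))  (inj₂ (_ , v<w))  (inj₂ (_ , w<u))  =
    contradiction (<-trans u<v (<-trans v<w w<u)) (Fin.<-irrefl refl)

C₃-has-no-TT₃ : ∀ {i j k} → C₃-Edge i j → C₃-Edge j k → ¬ C₃-Edge i k
C₃-has-no-TT₃ 0⟶1 1⟶2 ()
C₃-has-no-TT₃ 1⟶2 2⟶0 ()
C₃-has-no-TT₃ 2⟶0 0⟶1 ()

-- The graph H₆

-- The first row is the base transitive triangle; each later row closes one base edge into a cyclic
-- triangle with its own apex. As a list, the edges allow asymmetry to be decided by evaluation and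
-- homomorphisms to be given edge by edge.
H₆-edges : List (Fin 6 × Fin 6)
H₆-edges = (0F , 1F) ∷ (1F , 2F) ∷ (0F , 2F)
         ∷ (1F , 3F) ∷ (3F , 0F)
         ∷ (2F , 4F) ∷ (4F , 1F)
         ∷ (2F , 5F) ∷ (5F , 0F) ∷ []

open DecMembership (≡-dec (_≟_ {6}) (_≟_ {6})) using (_∈?_)

H₆ : OrientedGraph (Fin 6)
H₆ = record
  { _⟶_  = λ u v → (u , v) ∈ H₆-edges
  ; _⟶?_ = λ u v → (u , v) ∈? H₆-edges
  ; asym = λ uv → All.lookup no-2-cycle uv
  }
  where
  no-2-cycle : All (λ (u , v) → (v , u) ∉ H₆-edges) H₆-edges
  no-2-cycle = from-yes (All.all? (λ (u , v) → ¬? ((v , u) ∈? H₆-edges)) H₆-edges)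

H₆⋢D : ∀ s → ¬ (H₆ ⊑ D s)
H₆⋢D s (f , _ , f-hom) =
  C₃-has-no-TT₃ (crossing 0F 1F 3F) (crossing 1F 2F 4F) (crossing 0F 2F 5F)
  where
  crossing : ∀ u v w {uv : True ((u , v) ∈? H₆-edges)} {vw : True ((v , w) ∈? H₆-edges)}
             {wu : True ((w , u) ∈? H₆-edges)} → C₃-Edge (proj₁ (f u)) (proj₁ (f v))
  crossing _ _ _ {uv} {vw} {wu} = cyclic-triangle-crosses
    (f-hom _ _ (toWitness uv)) (f-hom _ _ (toWitness vw)) (f-hom _ _ (toWitness wu))

-- Regular tournaments

module _ {n : ℕ} (T : OrientedGraph (Fin n)) (T-reg : IsRegularTournament T) where

  open OrientedGraph T using () renaming (_⟶_ to _⇒_; _⟶?_ to _⇒?_)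
  open DecMembership (_≟_ {n}) using () renaming (_∈?_ to _∈ₗ?_)

  private
    tournament = proj₁ T-reg

    out in′ : Fin n → Fin n → ℕ
    out v w = 𝟙 (v ⇒? w)
    in′ v w = 𝟙 (w ⇒? v)

  sum-out : ∀ v → sum (out v) ≡ outDegree T v
  sum-out v = sym (count-tabulate (λ w → v ⇒? w) (λ i → i))

  sum-in : ∀ v → sum (in′ v) ≡ outDegree T v
  sum-in v = trans (sym (count-tabulate (λ w → w ⇒? v) (λ i → i))) (proj₂ T-reg v)

  order≤1+2·outDegree : ∀ v → n ≤ 1 + (outDegree T v + outDegree T v)
  order≤1+2·outDegree v = begin
    n                                                           ≡⟨ sum-1 n ⟨
    sum {n} (λ _ → 1)                                           ≤⟨ sum-mono-≤ trichotomy ⟩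
    sum (λ w → 𝟙 (v ≟ w) + (out v w + in′ v w))                 ≡⟨ ∑-distrib-+ (λ w → 𝟙 (v ≟ w)) (λ w → out v w + in′ v w) ⟩
    sum (λ w → 𝟙 (v ≟ w)) + sum (λ w → out v w + in′ v w)       ≡⟨ cong₂ _+_ (sum-𝟙-≟ v) (∑-distrib-+ (out v) (in′ v)) ⟩
    1 + (sum (out v) + sum (in′ v))                             ≡⟨ cong (1 +_) (cong₂ _+_ (sum-out v) (sum-in v)) ⟩
    1 + (outDegree T v + outDegree T v)                         ∎
    where
    open ≤-Reasoning

    trichotomy : ∀ w → 1 ≤ 𝟙 (v ≟ w) + (out v w + in′ v w)
    trichotomy w with v ≟ w
    ... | yes _  = s≤s z≤n
    ... | no v≢w with tournament v w v≢w
    ...   | inj₁ vw rewrite dec-true (v ⇒? w) vw = s≤s z≤n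
    ...   | inj₂ wv rewrite dec-true (w ⇒? v) wv = m≤n+m 1 (out v w)

  -- The single-vertex bound at the vertex of smaller out-degree suffices, so equality of all
  -- out-degrees need not be derived.
  order≤1+outDegrees : ∀ u v → n ≤ 1 + (outDegree T u + outDegree T v)
  order≤1+outDegrees u v with ≤-total (outDegree T u) (outDegree T v)
  ... | inj₁ u≤v = ≤-trans (order≤1+2·outDegree u) (s≤s (+-monoʳ-≤ (outDegree T u) u≤v))
  ... | inj₂ v≤u = ≤-trans (order≤1+2·outDegree v) (s≤s (+-monoˡ-≤ (outDegree T v) v≤u))

  out-neighbour-avoiding : ∀ v xs → length xs < outDegree T v → ∃[ w ] v ⇒ w × w ∉ xs
  out-neighbour-avoiding v xs xs<out =
    decidable-stable (any? λ w → v ⇒? w ×-dec ¬? (w ∈ₗ? xs)) λ none →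
      <⇒≱ xs<out (begin
        outDegree T v           ≡⟨ sum-out v ⟨
        sum (out v)             ≤⟨ sum-mono-≤ (covered none) ⟩
        sum (multiplicity xs)   ≡⟨ sum-multiplicity xs ⟩
        length xs               ∎)
    where
    open ≤-Reasoning

    covered : ¬ (∃[ w ] v ⇒ w × w ∉ xs) → ∀ w → out v w ≤ multiplicity xs w
    covered none w with v ⇒? w
    ... | no _   = z≤n
    ... | yes vw = ∈⇒multiplicity≥1 (decidable-stable (w ∈ₗ? xs) λ w∉ → none (w , vw , w∉))

  -- `N⁺(v)` and `N⁻(u)` have total size at least `n - 1` and both miss `ys`, so they share at least
  -- `length ys - 1` vertices, which is more than `xs` can cover.
  apex-avoiding : ∀ {u v} xs ys → Unique ys → All (λ w → ¬ v ⇒ w × ¬ w ⇒ u) ys →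
                  suc (length xs) < length ys → ∃[ w ] v ⇒ w × w ⇒ u × w ∉ xs
  apex-avoiding {u} {v} xs ys ys-uniq ys-out xs<ys =
    decidable-stable (any? λ w → v ⇒? w ×-dec w ⇒? u ×-dec ¬? (w ∈ₗ? xs)) λ none →
      <-irrefl refl (begin-strict
        d + length ys                                                 ≡⟨ cong₂ _+_ (cong₂ _+_ (sum-out v) (sum-in u)) (sum-multiplicity ys) ⟨
        (sum (out v) + sum (in′ u)) + sum (multiplicity ys)           ≡⟨ cong (_+ sum (multiplicity ys)) (∑-distrib-+ (out v) (in′ u)) ⟨
        sum (λ w → out v w + in′ u w) + sum (multiplicity ys)         ≡⟨ ∑-distrib-+ (λ w → out v w + in′ u w) (multiplicity ys) ⟨
        sum (λ w → (out v w + in′ u w) + multiplicity ys w)           ≤⟨ sum-mono-≤ (covered none) ⟩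
        sum (λ w → 1 + multiplicity xs w)                             ≡⟨ ∑-distrib-+ {n} (λ _ → 1) (multiplicity xs) ⟩
        sum {n} (λ _ → 1) + sum (multiplicity xs)                     ≡⟨ cong₂ _+_ (sum-1 n) (sum-multiplicity xs) ⟩
        n + length xs                                                 ≤⟨ +-monoˡ-≤ (length xs) (order≤1+outDegrees v u) ⟩
        (1 + d) + length xs                                           ≡⟨ +-suc d (length xs) ⟨
        d + suc (length xs)                                           <⟨ +-monoʳ-< d xs<ys ⟩
        d + length ys                                                 ∎)
    where
    open ≤-Reasoning

    d = outDegree T v + outDegree T u

    -- A left side of 2 arises only for `w` in both neighbourhoods, and such a `w` lies in `xs`; a
    -- member of `ys` lies in neither neighbourhood.
    covered : ¬ (∃[ w ] v ⇒ w × w ⇒ u × w ∉ xs) → ∀ w →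
              (out v w + in′ u w) + multiplicity ys w ≤ 1 + multiplicity xs w
    covered none w with v ⇒? w | w ⇒? u
    ... | yes vw | yes wu rewrite ∉⇒multiplicity≡0 ys (λ w∈ → proj₁ (All.lookup ys-out w∈) vw) =
      s≤s (∈⇒multiplicity≥1 (decidable-stable (w ∈ₗ? xs) λ w∉ → none (w , vw , wu , w∉)))
    ... | yes vw | no _   rewrite ∉⇒multiplicity≡0 ys (λ w∈ → proj₁ (All.lookup ys-out w∈) vw) = s≤s z≤n
    ... | no _   | yes wu rewrite ∉⇒multiplicity≡0 ys (λ w∈ → proj₂ (All.lookup ys-out w∈) wu) = s≤s z≤n
    ... | no _   | no _   = ≤-trans (unique⇒multiplicity≤1 ys-uniq w) (s≤s z≤n)

  cyclic-triangle : ∀ {u v} → u ⇒ v → ∃[ w ] v ⇒ w × w ⇒ u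
  cyclic-triangle {u} {v} uv =
    let w , vw , wu , _ = apex-avoiding {u} {v} [] (u ∷ v ∷ [])
          ((⟶⇒≢ T uv ∷ []) ∷ [] ∷ [])
          ((asym T uv , λ uu → asym T uu uu) ∷ ((λ vv → asym T vv vv) , asym T uv) ∷ [])
          (s≤s (s≤s z≤n))
    in  w , vw , wu

  out-neighbours : ∀ v k → k ≤ outDegree T v →
                   ∃[ ws ] length ws ≡ k × Unique ws × All (v ⇒_) ws
  out-neighbours v zero    _     = [] , refl , [] , []
  out-neighbours v (suc k) k<out =
    let ws , ∣ws∣≡k , ws-uniq , v⇒ws = out-neighbours v k (<⇒≤ k<out)
        w , vw , w∉ws = out-neighbour-avoiding v ws (subst (_< outDegree T v) (sym ∣ws∣≡k) k<out)
    in  w ∷ ws , cong suc ∣ws∣≡k , ¬Any⇒All¬ ws w∉ws ∷ ws-uniq , vw ∷ v⇒ws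

  -- For `P = (b ⇒_)` this yields the transitive triangle `b`, `c`, `d` together with a second
  -- middle vertex `c′` for the edge from `b` to `d`.
  TwoInNeighbours : Pred (Fin n) _ → Set
  TwoInNeighbours P =
    ∃[ c ] ∃[ c′ ] ∃[ d ] (P c × P c′ × P d) × c ≢ c′ × c ⇒ d × c′ ⇒ d

  -- Either `w` or `x` joins `u` as an in-neighbour of `v`, or `v` beats both, and then the head of
  -- the edge between `w` and `x` has `v` and the tail as in-neighbours.
  two-in-neighbours-near-edge : ∀ {P u v w x} → P u → P v → P w → P x → u ⇒ v →
    u ≢ w → u ≢ x → v ≢ w → v ≢ x → w ≢ x → TwoInNeighbours P
  two-in-neighbours-near-edge {_} {u} {v} {w} {x} pu pv pw px uv u≢w u≢x v≢w v≢x w≢x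
    with tournament v w v≢w | tournament v x v≢x | tournament w x w≢x
  ... | inj₂ wv | _       | _       = u , w , v , (pu , pw , pv) , u≢w , uv , wv
  ... | inj₁ _  | inj₂ xv | _       = u , x , v , (pu , px , pv) , u≢x , uv , xv
  ... | inj₁ _  | inj₁ vx | inj₁ wx = v , w , x , (pv , pw , px) , v≢w , vx , wx
  ... | inj₁ vw | inj₁ _  | inj₂ xw = v , x , w , (pv , px , pw) , v≢x , vw , xw

  -- Four vertices span six edges, so some in-degree is at least two; three vertices could form a
  -- cyclic triangle. The cases only orient the first pair.
  two-in-neighbours : ∀ {P} ws → length ws ≡ 4 → Unique ws → All P ws → TwoInNeighbours P
  two-in-neighbours (u ∷ v ∷ w ∷ x ∷ []) refl
    ((u≢v ∷ u≢w ∷ u≢x ∷ []) ∷ (v≢w ∷ v≢x ∷ []) ∷ (w≢x ∷ []) ∷ [] ∷ [])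
    (pu ∷ pv ∷ pw ∷ px ∷ [])
    with tournament u v u≢v
  ... | inj₁ uv = two-in-neighbours-near-edge pu pv pw px uv u≢w u≢x v≢w v≢x w≢x
  ... | inj₂ vu = two-in-neighbours-near-edge pv pu pw px vu v≢w v≢x u≢w u≢x w≢x

  H₆-⊑-via : ∀ {b} → TwoInNeighbours (b ⇒_) → H₆ ⊑ T
  H₆-⊑-via {b} (c , c′ , d , (bc , bc′ , bd) , c≢c′ , cd , c′d) =
    lookup f , lookup-injective f-uniq _ _ , λ u v → All.lookup f-hom
    where
    x-apex = cyclic-triangle bc
    x  = proj₁ x-apex
    cx = proj₁ (proj₂ x-apex)
    xb = proj₂ (proj₂ x-apex)

    y-apex = cyclic-triangle cd
    y  = proj₁ y-apex
    dy = proj₁ (proj₂ y-apex)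
    yc = proj₂ (proj₂ y-apex)

    -- The middle vertices `c` and `c′` raise the number of missed vertices to four, hence the
    -- number of apexes to at least three: one remains besides `x` and `y`.
    z-apex = apex-avoiding {b} {d} (x ∷ y ∷ []) (b ∷ d ∷ c ∷ c′ ∷ [])
      ((⟶⇒≢ T bd ∷ ⟶⇒≢ T bc ∷ ⟶⇒≢ T bc′ ∷ []) ∷
       (≢-sym (⟶⇒≢ T cd) ∷ ≢-sym (⟶⇒≢ T c′d) ∷ []) ∷ (c≢c′ ∷ []) ∷ [] ∷ [])
      ((asym T bd , λ bb → asym T bb bb) ∷ ((λ dd → asym T dd dd) , asym T bd) ∷
       (asym T cd , asym T bc) ∷ (asym T c′d , asym T bc′) ∷ [])
      ≤-refl
    z  = proj₁ z-apex
    dz = proj₁ (proj₂ z-apex)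
    zb = proj₁ (proj₂ (proj₂ z-apex))
    z∉ = proj₂ (proj₂ (proj₂ z-apex))

    f : Vec (Fin n) 6
    f = b ∷ c ∷ d ∷ x ∷ y ∷ z ∷ []

    f-uniq : VecUnique.Unique f
    -- Each pair is joined by an edge or by a directed path of length two, except `x`, `z` and `y`,
    -- `z`, which the choice of `z` separates.
    f-uniq =
      (⟶⇒≢ T bc ∷ ⟶⇒≢ T bd ∷ ≢-sym (⟶⇒≢ T xb) ∷ path-ends-≢ T bd dy ∷ ≢-sym (⟶⇒≢ T zb) ∷ []) ∷
      (⟶⇒≢ T cd ∷ ⟶⇒≢ T cx ∷ ≢-sym (⟶⇒≢ T yc) ∷ path-ends-≢ T cd dz ∷ []) ∷
      (≢-sym (path-ends-≢ T xb bd) ∷ ⟶⇒≢ T dy ∷ ⟶⇒≢ T dz ∷ []) ∷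
      (≢-sym (path-ends-≢ T yc cx) ∷ (λ x≡z → z∉ (here (sym x≡z))) ∷ []) ∷
      ((λ y≡z → z∉ (there (here (sym y≡z)))) ∷ []) ∷
      [] ∷ []

    f-hom : All (λ (u , v) → lookup f u ⇒ lookup f v) H₆-edges
    f-hom = bc ∷ cd ∷ bd ∷ cx ∷ xb ∷ dy ∷ yc ∷ dz ∷ zb ∷ []

H₆-Turánable : Turánable H₆
-- Out-degree at most 3 forces `n ≤ 7`, so from order 8 on there are the four out-neighbours needed.
H₆-Turánable = 8 , embed
  where
  embed : ∀ n → n ≥ 8 → (T : OrientedGraph (Fin n)) → IsRegularTournament T → H₆ ⊑ T
  embed n@(suc _) n≥8 T T-reg =
    let ws , ∣ws∣≡4 , ws-uniq , b⇒ws = out-neighbours T T-reg b 4 4≤out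
    in  H₆-⊑-via T T-reg (two-in-neighbours T T-reg ws ∣ws∣≡4 ws-uniq b⇒ws)
    where
    b : Fin n
    b = zero

    4≤out : 4 ≤ outDegree T b
    4≤out = ≮⇒≥ λ out<4 → <-irrefl refl (begin-strict
      n                                     ≤⟨ order≤1+2·outDegree T T-reg b ⟩
      1 + (outDegree T b + outDegree T b)   ≤⟨ s≤s (+-mono-≤ (s≤s⁻¹ out<4) (s≤s⁻¹ out<4)) ⟩
      7                                     <⟨ n≥8 ⟩
      n                                     ∎)
      where open ≤-Reasoning

-- The infinite family

H : ∀ i → OrientedGraph (Fin (i + 6))
H zero    = H₆
H (suc i) = addIsolated (H i)

H-Turánable : ∀ i → Turánable (H i)
H-Turánable zero    = H₆-Turánable
H-Turánable (suc i) = addIsolated-Turánable (H i) (H-Turánable i)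

H⋢D : ∀ i s → ¬ (H i ⊑ D s)
H⋢D zero    s = H₆⋢D s
H⋢D (suc i) s = H⋢D i s ∘ addIsolated-⊑⁻ (H i) {K = D s}

proposition1p2 : Σ[ order ∈ (ℕ → ℕ) ]
    Σ[ H ∈ ((i : ℕ) → OrientedGraph (Fin (order i))) ]
    (∀ i j → i ≢ j → ¬ (H i ≅ H j))
    × (∀ i → Turánable (H i))
    × (∀ i s → s ≥ 1 → ¬ (H i ⊑ D s))
proposition1p2 =
  (_+ 6) , H
  -- Members of the family are told apart by their orders `i + 6`.
  , (λ i j i≢j Hi≅Hj → i≢j (+-cancelʳ-≡ 6 i j (≅⇒order≡ {G = H i} {H = H j} Hi≅Hj)))
  , H-Turánable
  , λ i s _ → H⋢D i s
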